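{- An infinitary pretopos with specification is a predicative topos.
   Context: A presheaf $P:\mathcal C^{\mathrm{op}}\to\mathbf{Set}$ is a virtual object if it preserves all limits that exist (in $\mathcal C^{\mathrm{op}}$). A subobject $P\to y c$ of a representable presheaf $yc=\mathcal C(-,c)$ whose domain $P$ is a virtual object is called a virtual subobject of $c$. A category has specification if every virtual subobject is representable (i.e. for every virtual subobject $P\to yc$, $P$ is a representable presheaf). A predicative topos is a category $\mathcal C$ with finite limits that: (i) is virtually cartesian closed, i.e. $\mathcal C(-\times b,c)$ is a virtual object for all objects $b,c$; (ii) has specification; (iii) has a virtual subobject classifier, i.e. the subobject functor $\mathrm{Sub}:\mathcal C^{\mathrm{op}}\to\mathbf{Set}$ (acting on morphisms by pullback) is a virtual object. Infinitary pretopos has its standard meaning: an exact category that is infinitary extensive (small coproducts exist and are disjoint and stable under pullback). -}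

module Defs where

open import Data.Fin using (Fin)
open import Data.Fin.Patterns using (0F; 1F; 2F)
open import Data.Empty using (⊥-elim)
open import Data.Fin.Properties using (_≟_)
open import Data.Nat using (ℕ)
open import Data.Product using (Σ-syntax; _×_; _,_)
open import Data.Unit using (⊤; tt)
open import Function.Bundles using (Func; Inverse; _↔_)
open import Function.Construct.Identity using (↔-id)
open import Level using (Level; _⊔_; 0ℓ) renaming (suc to lsuc)
open import Relation.Binary.Bundles using (Setoid)
open import Relation.Binary.PropositionalEquality using (_≡_; refl; setoid)
open import Relation.Binary.Structures using (IsEquivalence)
open import Relation.Nullary using (Dec; yes; no)
import Relation.Binary.PropositionalEquality as ≡
import Relation.Binary.Reasoning.Setoid as SetoidReasoning

-- Hom-sets are setoids; objects carry no equality.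
record Category (o ℓ e : Level) : Set (lsuc (o ⊔ ℓ ⊔ e)) where
  infix  4 _≈_ _⇒_
  infixr 9 _∘_
  field
    Obj       : Set o
    _⇒_       : Obj → Obj → Set ℓ
    _≈_       : ∀ {a b} → a ⇒ b → a ⇒ b → Set e
    id        : ∀ {a} → a ⇒ a
    _∘_       : ∀ {a b c} → b ⇒ c → a ⇒ b → a ⇒ c
    assoc     : ∀ {a b c d} {f : a ⇒ b} {g : b ⇒ c} {h : c ⇒ d} →
                (h ∘ g) ∘ f ≈ h ∘ (g ∘ f)
    identityˡ : ∀ {a b} {f : a ⇒ b} → id ∘ f ≈ f
    identityʳ : ∀ {a b} {f : a ⇒ b} → f ∘ id ≈ f
    equiv     : ∀ {a b} → IsEquivalence (_≈_ {a} {b})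
    ∘-resp-≈  : ∀ {a b c} {f h : b ⇒ c} {g i : a ⇒ b} →
                f ≈ h → g ≈ i → f ∘ g ≈ h ∘ i

  hom-setoid : Obj → Obj → Setoid ℓ e
  hom-setoid a b = record { Carrier = a ⇒ b ; _≈_ = _≈_ ; isEquivalence = equiv }

  module Equiv {a b : Obj} = IsEquivalence (equiv {a} {b})
  module HomReasoning {a b : Obj} = SetoidReasoning (hom-setoid a b)

  ∘-resp-≈ˡ : ∀ {a b c} {f h : b ⇒ c} {g : a ⇒ b} → f ≈ h → f ∘ g ≈ h ∘ g
  ∘-resp-≈ˡ p = ∘-resp-≈ p Equiv.refl

  ∘-resp-≈ʳ : ∀ {a b c} {f : b ⇒ c} {g i : a ⇒ b} → g ≈ i → f ∘ g ≈ f ∘ i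
  ∘-resp-≈ʳ p = ∘-resp-≈ Equiv.refl p

op : ∀ {o ℓ e} → Category o ℓ e → Category o ℓ e
op C = record
  { Obj       = Obj
  ; _⇒_       = λ a b → b ⇒ a
  ; _≈_       = _≈_
  ; id        = id
  ; _∘_       = λ f g → g ∘ f
  ; assoc     = Equiv.sym assoc
  ; identityˡ = identityʳ
  ; identityʳ = identityˡ
  ; equiv     = equiv
  ; ∘-resp-≈  = λ p q → ∘-resp-≈ q p
  }
  where open Category C

record Functor {o ℓ e o′ ℓ′ e′} (C : Category o ℓ e) (D : Category o′ ℓ′ e′) :
               Set (o ⊔ ℓ ⊔ e ⊔ o′ ⊔ ℓ′ ⊔ e′) where
  private
    module C = Category C
    module D = Category D
  field
    F₀           : C.Obj → D.Obj
    F₁           : ∀ {a b} → a C.⇒ b → F₀ a D.⇒ F₀ b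
    identity     : ∀ {a} → F₁ (C.id {a}) D.≈ D.id
    homomorphism : ∀ {a b c} {f : a C.⇒ b} {g : b C.⇒ c} →
                   F₁ (g C.∘ f) D.≈ F₁ g D.∘ F₁ f
    F-resp-≈     : ∀ {a b} {f g : a C.⇒ b} → f C.≈ g → F₁ f D.≈ F₁ g

opF : ∀ {o ℓ e o′ ℓ′ e′} {C : Category o ℓ e} {D : Category o′ ℓ′ e′} →
      Functor C D → Functor (op C) (op D)
opF F = record
  { F₀ = F₀ ; F₁ = F₁ ; identity = identity ; homomorphism = homomorphism ; F-resp-≈ = F-resp-≈ }
  where open Functor F

infixr 9 _∘F_
_∘F_ : ∀ {o ℓ e o′ ℓ′ e′ o″ ℓ″ e″}
       {A : Category o ℓ e} {B : Category o′ ℓ′ e′} {C : Category o″ ℓ″ e″} →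
       Functor B C → Functor A B → Functor A C
_∘F_ {C = C} G F = record
  { F₀           = λ a → G.F₀ (F.F₀ a)
  ; F₁           = λ f → G.F₁ (F.F₁ f)
  ; identity     = trans (G.F-resp-≈ F.identity) G.identity
  ; homomorphism = trans (G.F-resp-≈ F.homomorphism) G.homomorphism
  ; F-resp-≈     = λ p → G.F-resp-≈ (F.F-resp-≈ p)
  }
  where
    module F = Functor F
    module G = Functor G
    open Category.Equiv C

record NaturalTransformation {o ℓ e o′ ℓ′ e′} {C : Category o ℓ e} {D : Category o′ ℓ′ e′}
                             (F G : Functor C D) : Set (o ⊔ ℓ ⊔ ℓ′ ⊔ e′) where
  private
    module C = Category C
    module D = Category D
    module F = Functor F
    module G = Functor G
  field
    η       : ∀ a → F.F₀ a D.⇒ G.F₀ a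
    natural : ∀ {a b} (f : a C.⇒ b) → η b D.∘ F.F₁ f D.≈ G.F₁ f D.∘ η a

FunctorCategory : ∀ {o ℓ e o′ ℓ′ e′} → Category o ℓ e → Category o′ ℓ′ e′ →
                  Category (o ⊔ ℓ ⊔ e ⊔ o′ ⊔ ℓ′ ⊔ e′) (o ⊔ ℓ ⊔ ℓ′ ⊔ e′) (o ⊔ e′)
FunctorCategory C D = record
  { Obj       = Functor C D
  ; _⇒_       = NaturalTransformation
  ; _≈_       = λ α β → ∀ a → η α a ≈ η β a
  ; id        = record
    { η       = λ _ → id
    ; natural = λ _ → trans identityˡ (sym identityʳ)
    }
  ; _∘_       = λ β α → record
    { η       = λ a → η β a ∘ η α a
    ; natural = λ f →
        trans assoc (trans (∘-resp-≈ʳ (natural α f))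
        (trans (sym assoc) (trans (∘-resp-≈ˡ (natural β f)) assoc)))
    }
  ; assoc     = λ _ → assoc
  ; identityˡ = λ _ → identityˡ
  ; identityʳ = λ _ → identityʳ
  ; equiv     = record
    { refl  = λ _ → Equiv.refl
    ; sym   = λ p a → sym (p a)
    ; trans = λ p q a → trans (p a) (q a)
    }
  ; ∘-resp-≈  = λ p q a → ∘-resp-≈ (p a) (q a)
  }
  where
    open NaturalTransformation
    open Category D
    open Equiv using (sym; trans)

Setoids : ∀ a b → Category (lsuc (a ⊔ b)) (a ⊔ b) (a ⊔ b)
Setoids a b = record
  { Obj       = Setoid a b
  ; _⇒_       = Func
  ; _≈_       = λ {A} {B} f g → ∀ x → Setoid._≈_ B (Func.to f x) (Func.to g x)
  ; id        = record { to = λ x → x ; cong = λ p → p }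
  ; _∘_       = λ g f → record
    { to   = λ x → Func.to g (Func.to f x)
    ; cong = λ p → Func.cong g (Func.cong f p)
    }
  ; assoc     = λ {d = D} _ → Setoid.refl D
  ; identityˡ = λ {b = B} _ → Setoid.refl B
  ; identityʳ = λ {b = B} _ → Setoid.refl B
  ; equiv     = λ {A} {B} → record
    { refl  = λ _ → Setoid.refl B
    ; sym   = λ p x → Setoid.sym B (p x)
    ; trans = λ p q x → Setoid.trans B (p x) (q x)
    }
  ; ∘-resp-≈  = λ {c = C} {f = f} p q x → Setoid.trans C (Func.cong f (q x)) (p _)
  }

module _ {o ℓ e o′ ℓ′ e′} {J : Category o ℓ e} {C : Category o′ ℓ′ e′} where
  private module J = Category J
  open Category C

  record Cone (D : Functor J C) : Set (o ⊔ ℓ ⊔ o′ ⊔ ℓ′ ⊔ e′) where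
    open Functor D
    field
      apex    : Obj
      ψ       : ∀ j → apex ⇒ F₀ j
      commute : ∀ {i j} (f : i J.⇒ j) → F₁ f ∘ ψ i ≈ ψ j

  open Cone

  record IsLimit {D : Functor J C} (K : Cone D) : Set (o ⊔ ℓ ⊔ o′ ⊔ ℓ′ ⊔ e′) where
    field
      mediate   : (L : Cone D) → apex L ⇒ apex K
      factors   : (L : Cone D) → ∀ j → ψ K j ∘ mediate L ≈ ψ L j
      unique    : (L : Cone D) (h : apex L ⇒ apex K) →
                  (∀ j → ψ K j ∘ h ≈ ψ L j) → h ≈ mediate L

  record Limit (D : Functor J C) : Set (o ⊔ ℓ ⊔ o′ ⊔ ℓ′ ⊔ e′) where
    field
      cone    : Cone D
      isLimit : IsLimit cone

mapCone : ∀ {o ℓ e o′ ℓ′ e′ o″ ℓ″ e″}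
          {J : Category o ℓ e} {C : Category o′ ℓ′ e′} {E : Category o″ ℓ″ e″}
          (F : Functor C E) {D : Functor J C} → Cone D → Cone (F ∘F D)
mapCone {E = E} F K = record
  { apex    = F₀ apex
  ; ψ       = λ j → F₁ (ψ j)
  ; commute = λ f → trans (sym homomorphism) (F-resp-≈ (commute f))
  }
  where
    open Functor F
    open Cone K
    open Category.Equiv E

-- No completeness of C is assumed: F preserves those limits of shape
-- J : Category s s s that happen to exist in C.
PreservesLimits : ∀ s {o ℓ e o′ ℓ′ e′} {C : Category o ℓ e} {E : Category o′ ℓ′ e′} →
                  Functor C E → Set (lsuc s ⊔ o ⊔ ℓ ⊔ e ⊔ o′ ⊔ ℓ′ ⊔ e′)
PreservesLimits s {C = C} F =
  (J : Category s s s) (D : Functor J C) (K : Cone D) → IsLimit K → IsLimit (mapCone F K)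

record IsFinite {o ℓ e} (J : Category o ℓ e) : Set (o ⊔ ℓ ⊔ e) where
  open Category J
  field
    #Obj   : ℕ
    finObj : Obj ↔ Fin #Obj
    #Hom   : Obj → Obj → ℕ
    finHom : ∀ i j → Inverse (hom-setoid i j) (setoid (Fin (#Hom i j)))

HasFiniteLimits : ∀ {o ℓ e} → Category o ℓ e → Set (lsuc 0ℓ ⊔ o ⊔ ℓ ⊔ e)
HasFiniteLimits C = (J : Category 0ℓ 0ℓ 0ℓ) → IsFinite J → (D : Functor J C) → Limit D

module _ {o ℓ e} (C : Category o ℓ e) where
  open Category C

  Mono : ∀ {a b} → a ⇒ b → Set (o ⊔ ℓ ⊔ e)
  Mono {a} f = ∀ {x} (g h : x ⇒ a) → f ∘ g ≈ f ∘ h → g ≈ h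

  infix 4 _≅_
  record _≅_ (a b : Obj) : Set (ℓ ⊔ e) where
    field
      to   : a ⇒ b
      from : b ⇒ a
      isoˡ : from ∘ to ≈ id
      isoʳ : to ∘ from ≈ id

  record IsProduct {a b p : Obj} (π₁ : p ⇒ a) (π₂ : p ⇒ b) : Set (o ⊔ ℓ ⊔ e) where
    field
      ⟨_,_⟩    : ∀ {x} → x ⇒ a → x ⇒ b → x ⇒ p
      project₁ : ∀ {x} {f : x ⇒ a} {g : x ⇒ b} → π₁ ∘ ⟨ f , g ⟩ ≈ f
      project₂ : ∀ {x} {f : x ⇒ a} {g : x ⇒ b} → π₂ ∘ ⟨ f , g ⟩ ≈ g
      unique   : ∀ {x} {f : x ⇒ a} {g : x ⇒ b} {h : x ⇒ p} →
                 π₁ ∘ h ≈ f → π₂ ∘ h ≈ g → h ≈ ⟨ f , g ⟩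

  record Product (a b : Obj) : Set (o ⊔ ℓ ⊔ e) where
    field
      {obj}     : Obj
      π₁        : obj ⇒ a
      π₂        : obj ⇒ b
      isProduct : IsProduct π₁ π₂
    open IsProduct isProduct public

  record IsPullback {a b c p : Obj} (f : a ⇒ c) (g : b ⇒ c) (p₁ : p ⇒ a) (p₂ : p ⇒ b) :
                    Set (o ⊔ ℓ ⊔ e) where
    field
      commute   : f ∘ p₁ ≈ g ∘ p₂
      universal : ∀ {x} {h : x ⇒ a} {k : x ⇒ b} → f ∘ h ≈ g ∘ k → x ⇒ p
      project₁  : ∀ {x} {h : x ⇒ a} {k : x ⇒ b} {eq : f ∘ h ≈ g ∘ k} →
                  p₁ ∘ universal eq ≈ h
      project₂  : ∀ {x} {h : x ⇒ a} {k : x ⇒ b} {eq : f ∘ h ≈ g ∘ k} →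
                  p₂ ∘ universal eq ≈ k
      unique    : ∀ {x} {h : x ⇒ a} {k : x ⇒ b} {eq : f ∘ h ≈ g ∘ k} {u : x ⇒ p} →
                  p₁ ∘ u ≈ h → p₂ ∘ u ≈ k → u ≈ universal eq

  record Pullback {a b c : Obj} (f : a ⇒ c) (g : b ⇒ c) : Set (o ⊔ ℓ ⊔ e) where
    field
      {obj}      : Obj
      p₁         : obj ⇒ a
      p₂         : obj ⇒ b
      isPullback : IsPullback f g p₁ p₂
    open IsPullback isPullback public

  record IsCoequalizer {a b q : Obj} (f g : a ⇒ b) (π : b ⇒ q) : Set (o ⊔ ℓ ⊔ e) where
    field
      equality   : π ∘ f ≈ π ∘ g
      coequalize : ∀ {x} {h : b ⇒ x} → h ∘ f ≈ h ∘ g → q ⇒ x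
      factors    : ∀ {x} {h : b ⇒ x} {eq : h ∘ f ≈ h ∘ g} → coequalize eq ∘ π ≈ h
      unique     : ∀ {x} {h : b ⇒ x} {eq : h ∘ f ≈ h ∘ g} {u : q ⇒ x} →
                   u ∘ π ≈ h → u ≈ coequalize eq

  IsRegularEpi : ∀ {b q} → b ⇒ q → Set (o ⊔ ℓ ⊔ e)
  IsRegularEpi {b} π = Σ[ a ∈ Obj ] Σ[ f ∈ a ⇒ b ] Σ[ g ∈ a ⇒ b ] IsCoequalizer f g π

  record IsCoproduct {i} {I : Set i} (X : I → Obj) {s : Obj} (ι : ∀ k → X k ⇒ s) :
                     Set (i ⊔ o ⊔ ℓ ⊔ e) where
    field
      copair  : ∀ {x} → (∀ k → X k ⇒ x) → s ⇒ x
      factors : ∀ {x} {f : ∀ k → X k ⇒ x} k → copair f ∘ ι k ≈ f k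
      unique  : ∀ {x} {f : ∀ k → X k ⇒ x} {h : s ⇒ x} → (∀ k → h ∘ ι k ≈ f k) → h ≈ copair f

  record Coproduct {i} {I : Set i} (X : I → Obj) : Set (i ⊔ o ⊔ ℓ ⊔ e) where
    field
      {obj}       : Obj
      ι           : ∀ k → X k ⇒ obj
      isCoproduct : IsCoproduct X ι
    open IsCoproduct isCoproduct public

  record IsEquivalenceRelation {r a : Obj} (p q : r ⇒ a) : Set (o ⊔ ℓ ⊔ e) where
    field
      jointlyMonic : ∀ {x} (g h : x ⇒ r) → p ∘ g ≈ p ∘ h → q ∘ g ≈ q ∘ h → g ≈ h
      reflexive    : Σ[ ρ ∈ a ⇒ r ] (p ∘ ρ ≈ id × q ∘ ρ ≈ id)
      symmetric    : Σ[ σ ∈ r ⇒ r ] (p ∘ σ ≈ q × q ∘ σ ≈ p)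
      transitive   : ∀ {t} {u v : t ⇒ r} → IsPullback q p u v →
                     Σ[ τ ∈ t ⇒ r ] (p ∘ τ ≈ p ∘ u × q ∘ τ ≈ q ∘ v)

private
  module FinitePreorder {n : ℕ} (_⊑_ : Fin n → Fin n → Set)
                        (reflexive : ∀ {i} → i ⊑ i)
                        (transitive : ∀ {i j k} → i ⊑ j → j ⊑ k → i ⊑ k)
                        (_⊑?_ : ∀ i j → Dec (i ⊑ j)) where

    shape : Category 0ℓ 0ℓ 0ℓ
    shape = record
      { Obj       = Fin n
      ; _⇒_       = _⊑_
      ; _≈_       = λ _ _ → ⊤
      ; id        = reflexive
      ; _∘_       = λ q p → transitive p q
      ; assoc     = tt
      ; identityˡ = tt
      ; identityʳ = tt
      ; equiv     = record { refl = tt ; sym = λ _ → tt ; trans = λ _ _ → tt }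
      ; ∘-resp-≈  = λ _ _ → tt
      }

    private
      count : ∀ {i j} → Dec (i ⊑ j) → ℕ
      count (yes _) = 1
      count (no _)  = 0

      enumerate : ∀ {i j} (d : Dec (i ⊑ j)) →
                  Inverse (Category.hom-setoid shape i j) (setoid (Fin (count d)))
      enumerate (yes p) = record
        { to        = λ _ → 0F
        ; from      = λ _ → p
        ; to-cong   = λ _ → refl
        ; from-cong = λ _ → tt
        ; inverse   = (λ { {0F} _ → refl }) , (λ _ → tt)
        }
      enumerate (no ¬p) = record
        { to        = λ p → ⊥-elim (¬p p)
        ; from      = λ ()
        ; to-cong   = λ {p} → ⊥-elim (¬p p)
        ; from-cong = λ { {()} }
        ; inverse   = (λ { {()} }) , (λ _ → tt)
        }

    isFinite : IsFinite shape
    isFinite = record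
      { #Obj   = n
      ; finObj = ↔-id _
      ; #Hom   = λ i j → count (i ⊑? j)
      ; finHom = λ i j → enumerate (i ⊑? j)
      }

  module Pair = FinitePreorder {2} _≡_ refl ≡.trans _≟_

  data _⊑_ : Fin 3 → Fin 3 → Set where
    stay  : ∀ {i} → i ⊑ i
    left  : 0F ⊑ 2F
    right : 1F ⊑ 2F

  ⊑-trans : ∀ {i j k} → i ⊑ j → j ⊑ k → i ⊑ k
  ⊑-trans stay  q    = q
  ⊑-trans left  stay = left
  ⊑-trans right stay = right

  _⊑?_ : ∀ i j → Dec (i ⊑ j)
  0F ⊑? 0F = yes stay
  0F ⊑? 1F = no λ ()
  0F ⊑? 2F = yes left
  1F ⊑? 0F = no λ ()
  1F ⊑? 1F = yes stay
  1F ⊑? 2F = yes right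
  2F ⊑? 0F = no λ ()
  2F ⊑? 1F = no λ ()
  2F ⊑? 2F = yes stay

  module Cospan = FinitePreorder _⊑_ stay ⊑-trans _⊑?_

module FiniteLimits {o ℓ e} {C : Category o ℓ e} (lim : HasFiniteLimits C) where
  open Category C
  open Equiv renaming (refl to ≈-refl)

  private
    pairDiagram : Obj → Obj → Functor Pair.shape C
    pairDiagram a b = record
      { F₀           = F₀
      ; F₁           = λ { refl → id }
      ; identity     = ≈-refl
      ; homomorphism = λ { {f = refl} {refl} → sym identityˡ }
      ; F-resp-≈     = λ { {f = refl} {refl} _ → ≈-refl }
      }
      where
        F₀ : Fin 2 → Obj
        F₀ 0F = a
        F₀ 1F = b

    pairCone : ∀ {a b x} → x ⇒ a → x ⇒ b → Cone (pairDiagram a b)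
    pairCone f g = record
      { ψ       = λ { 0F → f ; 1F → g }
      ; commute = λ { refl → identityˡ }
      }

  product : ∀ a b → Product C a b
  product a b = record
    { π₁        = ψ 0F
    ; π₂        = ψ 1F
    ; isProduct = record
      { ⟨_,_⟩    = λ f g → mediate (pairCone f g)
      ; project₁ = λ {_} {f} {g} → factors (pairCone f g) 0F
      ; project₂ = λ {_} {f} {g} → factors (pairCone f g) 1F
      ; unique   = λ {_} {f} {g} {h} p q → unique (pairCone f g) h λ { 0F → p ; 1F → q }
      }
    }
    where
      open Limit (lim Pair.shape Pair.isFinite (pairDiagram a b))
      open Cone cone
      open IsLimit isLimit

  private
    cospanDiagram : ∀ {a b c} → a ⇒ c → b ⇒ c → Functor Cospan.shape C
    cospanDiagram {a} {b} {c} f g = record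
      { F₀           = F₀
      ; F₁           = F₁
      ; identity     = ≈-refl
      ; homomorphism = λ {_} {_} {_} {p} {q} → homomorphism p q
      ; F-resp-≈     = λ {_} {_} {p} {q} _ → resp p q
      }
      where
        F₀ : Fin 3 → Obj
        F₀ 0F = a
        F₀ 1F = b
        F₀ 2F = c

        F₁ : ∀ {i j} → i ⊑ j → F₀ i ⇒ F₀ j
        F₁ stay  = id
        F₁ left  = f
        F₁ right = g

        homomorphism : ∀ {i j k} (p : i ⊑ j) (q : j ⊑ k) → F₁ (⊑-trans p q) ≈ F₁ q ∘ F₁ p
        homomorphism stay  q    = sym identityʳ
        homomorphism left  stay = sym identityˡ
        homomorphism right stay = sym identityˡ

        resp : ∀ {i j} (p q : i ⊑ j) → F₁ p ≈ F₁ q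
        resp stay  stay  = ≈-refl
        resp left  left  = ≈-refl
        resp right right = ≈-refl

    cospanCone : ∀ {a b c x} {f : a ⇒ c} {g : b ⇒ c} {h : x ⇒ a} {k : x ⇒ b} →
                 f ∘ h ≈ g ∘ k → Cone (cospanDiagram f g)
    cospanCone {f = f} {h = h} {k} eq = record
      { ψ       = λ { 0F → h ; 1F → k ; 2F → f ∘ h }
      ; commute = λ { stay → identityˡ ; left → ≈-refl ; right → sym eq }
      }

  pullback : ∀ {a b c} (f : a ⇒ c) (g : b ⇒ c) → Pullback C f g
  pullback f g = record
    { p₁         = ψ 0F
    ; p₂         = ψ 1F
    ; isPullback = record
      { commute   = trans (commute left) (sym (commute right))
      ; universal = λ eq → mediate (cospanCone eq)
      ; project₁  = λ {_} {_} {_} {eq} → factors (cospanCone eq) 0F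
      ; project₂  = λ {_} {_} {_} {eq} → factors (cospanCone eq) 1F
      ; unique    = λ {_} {_} {_} {eq} {u} p q → unique (cospanCone eq) u λ
        { 0F → p
        ; 1F → q
        ; 2F → trans (∘-resp-≈ˡ (sym (commute left))) (trans assoc (∘-resp-≈ʳ p))
        }
      }
    }
    where
      open Limit (lim Cospan.shape Cospan.isFinite (cospanDiagram f g))
      open Cone cone
      open IsLimit isLimit

  -×_ : ∀ b → Functor C C
  -× b = record
    { F₀           = λ a → P.obj a
    ; F₁           = λ {a} {a′} f → P.⟨_,_⟩ a′ (f ∘ P.π₁ a) (P.π₂ a)
    ; identity     = λ {a} → sym (P.unique a (trans identityʳ (sym identityˡ)) identityʳ)
    ; homomorphism = λ {a} {a′} {a″} → sym (P.unique a″
        (trans (sym assoc) (trans (∘-resp-≈ˡ (P.project₁ a″)) (trans assoc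
          (trans (∘-resp-≈ʳ (P.project₁ a′)) (sym assoc)))))
        (trans (sym assoc) (trans (∘-resp-≈ˡ (P.project₂ a″)) (P.project₂ a′))))
    ; F-resp-≈     = λ {a} {a′} p → P.unique a′
        (trans (P.project₁ a′) (∘-resp-≈ˡ p)) (P.project₂ a′)
    }
    where module P a = Product (product a b)

module _ {o ℓ e} (C : Category o ℓ e) where
  open Category C

  record Exact : Set (lsuc 0ℓ ⊔ o ⊔ ℓ ⊔ e) where
    field
      finiteLimits     : HasFiniteLimits C
      kernelQuotient   : ∀ {r a b} {f : a ⇒ b} {p q : r ⇒ a} → IsPullback C f f p q →
                         Σ[ c ∈ Obj ] Σ[ π ∈ a ⇒ c ] IsCoequalizer C p q π
      regularEpiStable : ∀ {a b c d} {f : a ⇒ c} {g : b ⇒ c} {p₁ : d ⇒ a} {p₂ : d ⇒ b} →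
                         IsPullback C f g p₁ p₂ → IsRegularEpi C f → IsRegularEpi C p₂
      effective        : ∀ {r a} {p q : r ⇒ a} → IsEquivalenceRelation C p q →
                         Σ[ b ∈ Obj ] Σ[ f ∈ a ⇒ b ] IsPullback C f f p q

  -- The second field says that X i ×ₛ X j is initial unless i ≡ j: it is the
  -- coproduct of copies of itself indexed by i ≡ j (a proposition, by K).  For i ≢ j
  -- this is initiality (the empty coproduct) and for i ≡ j it is vacuous, so
  -- whenever equality on I is decidable (in particular classically) it is the
  -- usual condition.  Without decidability, "initial if i ≢ j" alone would be
  -- too weak.
  record Disjoint {i} {I : Set i} {X : I → Obj} {s : Obj} (ι : ∀ k → X k ⇒ s) :
                  Set (i ⊔ o ⊔ ℓ ⊔ e) where
    field
      injectionMono : ∀ k → Mono C (ι k)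
      intersection  : ∀ {i j p} {p₁ : p ⇒ X i} {p₂ : p ⇒ X j} →
                      IsPullback C (ι i) (ι j) p₁ p₂ →
                      IsCoproduct C {I = i ≡ j} (λ _ → p) (λ _ → id)

  -- Small coproducts are those indexed by types in the universe of the hom-sets.
  record InfinitaryExtensive : Set (lsuc ℓ ⊔ o ⊔ e) where
    field
      coproduct : {I : Set ℓ} (X : I → Obj) → Coproduct C X
      disjoint  : {I : Set ℓ} {X : I → Obj} {s : Obj} {ι : ∀ k → X k ⇒ s} →
                  IsCoproduct C X ι → Disjoint ι
      stable    : {I : Set ℓ} {X : I → Obj} {s : Obj} {ι : ∀ k → X k ⇒ s} →
                  IsCoproduct C X ι →
                  ∀ {t} (f : t ⇒ s) {Y : I → Obj} {κ : ∀ k → Y k ⇒ t} {g : ∀ k → Y k ⇒ X k} →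
                  (∀ k → IsPullback C f (ι k) (κ k) (g k)) →
                  IsCoproduct C Y κ

  record InfinitaryPretopos : Set (lsuc ℓ ⊔ o ⊔ e) where
    field
      exact     : Exact
      extensive : InfinitaryExtensive

module _ {o ℓ e} (C : Category o ℓ e) where
  open Category C

  Presheaf : ∀ a b → Set (o ⊔ ℓ ⊔ e ⊔ lsuc (a ⊔ b))
  Presheaf a b = Functor (op C) (Setoids a b)

  Presheaves : ∀ a b → Category (o ⊔ ℓ ⊔ e ⊔ lsuc (a ⊔ b)) (o ⊔ ℓ ⊔ a ⊔ b) (o ⊔ a ⊔ b)
  Presheaves a b = FunctorCategory (op C) (Setoids a b)

  よ : Obj → Presheaf ℓ e
  よ c = record
    { F₀           = λ a → hom-setoid a c
    ; F₁           = λ f → record { to = λ g → g ∘ f ; cong = ∘-resp-≈ˡ }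
    ; identity     = λ _ → identityʳ
    ; homomorphism = λ _ → Equiv.sym assoc
    ; F-resp-≈     = λ p _ → ∘-resp-≈ʳ p
    }

  IsRepresentable : Presheaf ℓ e → Set (o ⊔ ℓ ⊔ e)
  IsRepresentable P = Σ[ c ∈ Obj ] (_≅_ (Presheaves ℓ e) P (よ c))

  record Subobject (c : Obj) : Set (o ⊔ ℓ ⊔ e) where
    field
      {dom} : Obj
      arr   : dom ⇒ c
      mono  : Mono C arr

  open Subobject

  infix 4 _≤_
  _≤_ : ∀ {c} → Subobject c → Subobject c → Set (ℓ ⊔ e)
  S ≤ T = Σ[ f ∈ dom S ⇒ dom T ] arr T ∘ f ≈ arr S

  subobjects : Obj → Setoid (o ⊔ ℓ ⊔ e) (ℓ ⊔ e)
  subobjects c = record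
    { Carrier       = Subobject c
    ; _≈_           = λ S T → S ≤ T × T ≤ S
    ; isEquivalence = record
      { refl  = (id , identityʳ) , (id , identityʳ)
      ; sym   = λ (p , q) → q , p
      ; trans = λ {S} {T} {U} (p , p′) (q , q′) → ≤-trans S T U p q , ≤-trans U T S q′ p′
      }
    }
    where
      ≤-trans : ∀ (S T U : Subobject c) → S ≤ T → T ≤ U → S ≤ U
      ≤-trans S T U (f , p) (g , q) =
        g ∘ f , Equiv.trans (Equiv.sym assoc) (Equiv.trans (∘-resp-≈ˡ q) p)

  module _ (lim : HasFiniteLimits C) where
    open FiniteLimits lim
    open Equiv renaming (refl to ≈-refl)

    private
      module PB {c d} (f : d ⇒ c) (S : Subobject c) = Pullback (pullback f (arr S))

    infix 10 _*_
    _*_ : ∀ {c d} → d ⇒ c → Subobject c → Subobject d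
    f * S = record
      { arr  = PB.p₁ f S
      ; mono = λ g h eq →
          let eq₂ = mono S (PB.p₂ f S ∘ g) (PB.p₂ f S ∘ h)
                      (trans (square g) (trans (∘-resp-≈ʳ eq) (sym (square h))))
              com = trans (sym assoc) (trans (∘-resp-≈ˡ (PB.commute f S)) assoc)
          in trans (PB.unique f S {eq = com} ≈-refl ≈-refl)
                   (sym (PB.unique f S (sym eq) (sym eq₂)))
      }
      where
        square : ∀ {x} (g : x ⇒ PB.obj f S) → arr S ∘ (PB.p₂ f S ∘ g) ≈ f ∘ (PB.p₁ f S ∘ g)
        square g = trans (sym assoc) (trans (∘-resp-≈ˡ (sym (PB.commute f S))) assoc)

    private
      -- T ≤ f * S as soon as f ∘ arr T factors through arr S.
      lift : ∀ {c d} {f : d ⇒ c} {S : Subobject c} {T : Subobject d} (k : dom T ⇒ dom S) →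
             f ∘ arr T ≈ arr S ∘ k → T ≤ f * S
      lift {f = f} {S} k eq = PB.universal f S eq , PB.project₁ f S

    Sub : Presheaf (o ⊔ ℓ ⊔ e) (ℓ ⊔ e)
    Sub = record
      { F₀           = subobjects
      ; F₁           = λ f → record
        { to   = f *_
        ; cong = λ {S} {T} (p , q) → *-monotone f S T p , *-monotone f T S q
        }
      ; identity     = λ S →
            (PB.p₂ id S , trans (sym (PB.commute id S)) identityˡ)
          , lift {f = id} {S} {S} id (trans identityˡ (sym identityʳ))
      ; homomorphism = λ {_} {_} {_} {f} {g} S →
            lift {f = g} {f * S} {(f ∘ g) * S}
              (PB.universal f S (trans (sym assoc) (PB.commute (f ∘ g) S)))
              (sym (PB.project₁ f S))
          , lift {f = f ∘ g} {S} {g * (f * S)} (PB.p₂ f S ∘ PB.p₂ g (f * S))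
              (trans assoc (trans (∘-resp-≈ʳ (PB.commute g (f * S)))
              (trans (sym assoc) (trans (∘-resp-≈ˡ (PB.commute f S)) assoc))))
      ; F-resp-≈     = λ p S → change S p , change S (sym p)
      }
      where
        *-monotone : ∀ {c d} (f : d ⇒ c) (S T : Subobject c) → S ≤ T → f * S ≤ f * T
        *-monotone f S T (k , eq) = lift {f = f} {T} {f * S} (k ∘ PB.p₂ f S)
          (trans (PB.commute f S) (trans (∘-resp-≈ˡ (sym eq)) assoc))

        change : ∀ {c d} {f g : d ⇒ c} (S : Subobject c) → f ≈ g → f * S ≤ g * S
        change {f = f} {g} S p = lift {f = g} {S} {f * S} (PB.p₂ f S)
          (trans (∘-resp-≈ˡ (sym p)) (PB.commute f S))

-- C is locally small: its hom-sets live in the universe Set ℓ of small sets,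
-- while its objects may form a large type.  "Small" refers to Set ℓ throughout.
module _ {o ℓ} (C : Category o ℓ ℓ) where
  open Category C

  IsVirtual : ∀ {a b} → Presheaf C a b → Set (lsuc ℓ ⊔ o ⊔ lsuc (a ⊔ b))
  IsVirtual P = PreservesLimits ℓ P

  HasSpecification : Set (o ⊔ lsuc ℓ)
  HasSpecification =
    (c : Obj) (P : Presheaf C ℓ ℓ) (m : Category._⇒_ (Presheaves C ℓ ℓ) P (よ C c)) →
    Mono (Presheaves C ℓ ℓ) m → IsVirtual P → IsRepresentable C P

  record PredicativeTopos : Set (lsuc (o ⊔ ℓ)) where
    field
      finiteLimits               : HasFiniteLimits C
    open FiniteLimits finiteLimits
    field
      virtuallyCartesianClosed   : ∀ b c → IsVirtual (よ C c ∘F opF (-× b))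
      specification              : HasSpecification
      virtualSubobjectClassifier : IsVirtual (Sub C finiteLimits)

{-# OPTIONS --safe #-}

-- In an infinitary pretopos every colimit X of a diagram Xⱼ is well behaved: the map
-- q : P = ∐ Xⱼ → X is a regular epi (its image receives the cocone), and its kernel
-- pair is the equivalence relation on P generated by the transition maps.  The latter
-- exists as the image of a small coproduct of iterated pullbacks, one for each formal
-- derivation; it is the kernel pair of some map by effectiveness, that map is a cocone,
-- and hence it factors through q.  So if u, v : T → P agree in X, then on a cover of T
-- they are linked by zigzags of transition maps.  A compatible family of maps
-- Xⱼ × b → c, or of subobjects of Xⱼ, is invariant along such zigzags and therefore
-- descends to X.
module Submission where

open import Defs
open import Data.Product using (Σ-syntax; _×_; _,_; proj₁; proj₂)
open import Function.Bundles using (Func)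
open import Level using (Level; _⊔_)
open import Relation.Binary.Bundles using (Setoid)
open import Relation.Binary.PropositionalEquality using (_≡_; refl)

-- Formal proofs of equivalence from the generators in `M`. They form a small type, so a coproduct
-- may be indexed by them.
data Derivation {ℓ} (M : Set ℓ) : Set ℓ where
  gen     : M → Derivation M
  reflex  : Derivation M
  symm    : Derivation M → Derivation M
  compose : Derivation M → Derivation M → Derivation M

module Pretopos {o ℓ} (C : Category o ℓ ℓ) (pretopos : InfinitaryPretopos C) where
  open Category C
  open Equiv using (sym; trans) renaming (refl to ≈-refl)
  open InfinitaryPretopos pretopos
  open Exact exact
  open InfinitaryExtensive extensive
  open FiniteLimits finiteLimits
  open Subobject

  -- Composites, pullbacks and binary products

  pullˡ : ∀ {a b c d} {f : c ⇒ d} {g : b ⇒ c} {h : b ⇒ d} {k : a ⇒ b} →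
          f ∘ g ≈ h → f ∘ (g ∘ k) ≈ h ∘ k
  pullˡ p = trans (sym assoc) (∘-resp-≈ˡ p)

  pullʳ : ∀ {a b c d} {f : c ⇒ d} {g : b ⇒ c} {h : a ⇒ c} {k : a ⇒ b} →
          g ∘ k ≈ h → (f ∘ g) ∘ k ≈ f ∘ h
  pullʳ p = trans assoc (∘-resp-≈ʳ p)

  IsPullback-swap : ∀ {a b c p} {f : a ⇒ c} {g : b ⇒ c} {p₁ : p ⇒ a} {p₂ : p ⇒ b} →
                    IsPullback C f g p₁ p₂ → IsPullback C g f p₂ p₁
  IsPullback-swap pb = record
    { commute   = sym commute
    ; universal = λ eq → universal (sym eq)
    ; project₁  = project₂
    ; project₂  = project₁
    ; unique    = λ p q → unique q p
    }
    where open IsPullback pb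

  module _ {a b : Obj} where
    open Product (product a b) public
      using (π₁; π₂; ⟨_,_⟩; project₁; project₂) renaming (unique to ⟨⟩-unique)

  infixr 8 _⊗_
  _⊗_ : Obj → Obj → Obj
  a ⊗ b = Product.obj (product a b)

  ⊗-ext : ∀ {a b t} {x y : t ⇒ a ⊗ b} → π₁ ∘ x ≈ π₁ ∘ y → π₂ ∘ x ≈ π₂ ∘ y → x ≈ y
  ⊗-ext p q = trans (⟨⟩-unique p q) (sym (⟨⟩-unique ≈-refl ≈-refl))

  ⟨⟩-cong : ∀ {a b t} {x y : t ⇒ a} {u v : t ⇒ b} → x ≈ y → u ≈ v → ⟨ x , u ⟩ ≈ ⟨ y , v ⟩
  ⟨⟩-cong p q = ⟨⟩-unique (trans project₁ p) (trans project₂ q)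

  ⟨⟩-∘ : ∀ {a b t s} {x : t ⇒ a} {u : t ⇒ b} {f : s ⇒ t} → ⟨ x , u ⟩ ∘ f ≈ ⟨ x ∘ f , u ∘ f ⟩
  ⟨⟩-∘ = ⟨⟩-unique (pullˡ project₁) (pullˡ project₂)

  -- Generalised elements of subobjects

  infix 4 _∈_
  -- `arr S ∈ T` unfolds to `S ≤ T`, so proofs of inclusion serve as proofs of membership and
  -- conversely.
  _∈_ : ∀ {t c} → t ⇒ c → Subobject C c → Set ℓ
  x ∈ S = Σ[ k ∈ _ ⇒ dom S ] arr S ∘ k ≈ x

  ∈-resp-≈ : ∀ {t c} {x y : t ⇒ c} {S : Subobject C c} → x ≈ y → x ∈ S → y ∈ S
  ∈-resp-≈ p (k , eq) = k , trans eq p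

  ∈-∘ : ∀ {s t c} {x : t ⇒ c} {S : Subobject C c} {f : s ⇒ t} → x ∈ S → x ∘ f ∈ S
  ∈-∘ (k , eq) = k ∘ _ , pullˡ eq

  ∈-≤ : ∀ {t c} {x : t ⇒ c} {S T : Subobject C c} → arr S ∈ T → x ∈ S → x ∈ T
  ∈-≤ (i , p) (k , eq) = i ∘ k , trans (pullˡ p) eq

  ∈-* : ∀ {t c d} {f : d ⇒ c} {S : Subobject C c} {x : t ⇒ d} →
        f ∘ x ∈ S → x ∈ _*_ C finiteLimits f S
  ∈-* {f = f} {S} (k , eq) = universal (sym eq) , project₁′
    where
      open Pullback (pullback f (arr S)) using (universal) renaming (project₁ to project₁′)

  ∈-*⁻¹ : ∀ {t c d} {f : d ⇒ c} {S : Subobject C c} {x : t ⇒ d} →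
          x ∈ _*_ C finiteLimits f S → f ∘ x ∈ S
  ∈-*⁻¹ {f = f} {S} (k , eq) =
    p₂ ∘ k , trans (pullˡ (sym commute)) (pullʳ eq)
    where
      open Pullback (pullback f (arr S)) using (p₂; commute)

  -- Testing membership and equality on covers

  diagonal : ∀ c → Subobject C (c ⊗ c)
  diagonal c = record
    { arr  = ⟨ id , id ⟩
    ; mono = λ g h eq → trans (sym (section g)) (trans (∘-resp-≈ʳ eq) (section h))
    }
    where
      section : ∀ {x} (g : x ⇒ c) → π₁ ∘ (⟨ id , id ⟩ ∘ g) ≈ g
      section g = trans (pullˡ project₁) identityˡ

  -- Φ holds on some cover of t.  Instead of naming the cover, quantify over the
  -- subobjects: membership in a subobject may be tested on a cover, and no other
  -- property of covers is needed.  Quantifying over f builds in stability under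
  -- pullback.
  Locally : ∀ {k} t → (∀ {z} → z ⇒ t → Set k) → Set (o ⊔ ℓ ⊔ k)
  Locally t Φ =
    ∀ {y c} (f : y ⇒ t) (x : y ⇒ c) (S : Subobject C c) →
    (∀ {z} (g : z ⇒ y) {h : z ⇒ t} → f ∘ g ≈ h → Φ h → x ∘ g ∈ S) → x ∈ S

  -- An equation is membership of a pair in the diagonal, so it too can be tested on a cover.
  locally-≈ : ∀ {k t} {Φ : ∀ {z} → z ⇒ t → Set k} → Locally t Φ →
              ∀ {y c} (f : y ⇒ t) {x x′ : y ⇒ c} →
              (∀ {z} (g : z ⇒ y) {h : z ⇒ t} → f ∘ g ≈ h → Φ h → x ∘ g ≈ x′ ∘ g) → x ≈ x′
  locally-≈ loc f {x} {x′} H =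
    let k , eq = loc f ⟨ x , x′ ⟩ (diagonal _) λ g p φ →
          x ∘ g , trans ⟨⟩-∘ (trans (⟨⟩-cong identityˡ (trans identityˡ (H g p φ))) (sym ⟨⟩-∘))
    in trans (trans (sym project₁) (∘-resp-≈ʳ (sym eq)))
       (trans (pullˡ project₁) (trans (sym (pullˡ project₂))
       (trans (∘-resp-≈ʳ eq) project₂)))

  -- The pullback of `e` along `f` is again a regular epi, and over it `x` lifts to `S`. As `arr S`
  -- is monic, the lift equalizes the pair defining that epi, and so descends.
  regularEpi-locally : ∀ {a b} {e : a ⇒ b} → IsRegularEpi C e →
                       Locally b λ {z} y → Σ[ x ∈ z ⇒ a ] e ∘ x ≈ y
  regularEpi-locally {e = e} epi f x S H =
    let k , eq = H p₂ (sym commute) (p₁ , ≈-refl)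
        _ , u , v , coeq = regularEpiStable isPullback epi
        open IsCoequalizer coeq
        ku≈kv = mono S _ _ (trans (pullˡ eq) (trans (pullʳ equality)
                  (sym (trans (pullˡ eq) assoc))))
    in coequalize ku≈kv
     , trans (unique {eq = trans (pullʳ equality) (sym assoc)}
               (trans assoc (trans (∘-resp-≈ʳ factors) eq)))
         (sym (unique ≈-refl))
    where open Pullback (pullback e f) using (p₁; p₂; commute; isPullback)

  -- By stability the domain of `f` is the coproduct of the pullbacks of the `ι k`; the lifts over
  -- these summands are copaired.
  coproduct-locally : ∀ {I : Set ℓ} {X : I → Obj} {s} {ι : ∀ k → X k ⇒ s} →
                      IsCoproduct C X ι →
                      Locally s λ {z} y → Σ[ k ∈ I ] Σ[ x ∈ z ⇒ X k ] ι k ∘ x ≈ y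
  coproduct-locally {ι = ι} coprod f x S H =
    copair (λ k → proj₁ (on k)) ,
    trans (unique λ k → trans (pullʳ (factors k)) (proj₂ (on k))) (sym (unique λ _ → ≈-refl))
    where
      module PB k = Pullback (pullback f (ι k))
      open IsCoproduct (stable coprod f PB.isPullback)
      on : ∀ k → x ∘ PB.p₁ k ∈ S
      on k = H (PB.p₁ k) (PB.commute k) (k , PB.p₂ k , ≈-refl)

  -- The equation sends `t` into the intersection of two summands, a coproduct of copies of itself
  -- indexed by `i ≡ j`. Locally choosing a summand of it yields the proof.
  disjoint-locally : ∀ {I : Set ℓ} {X : I → Obj} {s} {ι : ∀ k → X k ⇒ s} →
                     IsCoproduct C X ι →
                     ∀ {i j t} {x : t ⇒ X i} {y : t ⇒ X j} → ι i ∘ x ≈ ι j ∘ y →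
                     Locally t λ _ → i ≡ j
  disjoint-locally {ι = ι} coprod {i} {j} eq f x S H =
    coproduct-locally (Disjoint.intersection (disjoint coprod) isPullback)
      (universal eq ∘ f) x S λ g _ (p , _) → H g ≈-refl p
    where open Pullback (pullback (ι i) (ι j)) using (isPullback; universal)

  record Image {a b} (f : a ⇒ b) : Set (o ⊔ ℓ) where
    field
      sub        : Subobject C b
      cover      : a ⇒ dom sub
      factors    : arr sub ∘ cover ≈ f
      regularEpi : IsRegularEpi C cover

    ∈-image : ∀ {t} (x : t ⇒ a) → f ∘ x ∈ sub
    ∈-image x = cover ∘ x , pullˡ factors

    -- The converse of `∈-image`, on a cover.
    locally : Locally (dom sub) λ {z} y → Σ[ x ∈ z ⇒ a ] f ∘ x ≈ arr sub ∘ y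
    locally g x S H = regularEpi-locally regularEpi g x S λ h p (y , q) →
      H h p (y , trans (∘-resp-≈ˡ (sym factors)) (pullʳ q))

  image : ∀ {a b} (f : a ⇒ b) → Image f
  image {a} f = record
    { sub        = record { arr = m ; mono = m-mono }
    ; cover      = e
    ; factors    = factors
    ; regularEpi = epi
    }
    where
      open Pullback (pullback f f) using (p₁; p₂; isPullback; commute; universal)
        renaming (project₁ to project₁′; project₂ to project₂′)
      quotient = kernelQuotient isPullback
      e = proj₁ (proj₂ quotient)
      open IsCoequalizer (proj₂ (proj₂ quotient))
      m = coequalize commute
      epi : IsRegularEpi C e
      epi = _ , _ , _ , proj₂ (proj₂ quotient)

      e-identifies : ∀ {t} {x y : t ⇒ a} → f ∘ x ≈ f ∘ y → e ∘ x ≈ e ∘ y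
      e-identifies eq =
        trans (∘-resp-≈ʳ (sym project₁′))
        (trans (pullˡ equality) (pullʳ (project₂′ {eq = eq})))

      -- `g` and `h` are lifted along `e` on successive covers. The lifts agree under `f`, so they
      -- form an element of its kernel pair, which `e` identifies.
      m-mono : Mono C m
      m-mono g h eq =
        locally-≈ (regularEpi-locally epi) g λ r p (x , ex) →
        locally-≈ (regularEpi-locally epi) (h ∘ r) λ r′ p′ (y , ey) →
          let gx : (g ∘ r) ∘ r′ ≈ e ∘ (x ∘ r′)
              gx = trans (∘-resp-≈ˡ (trans p (sym ex))) assoc
              hy : (h ∘ r) ∘ r′ ≈ e ∘ y
              hy = trans p′ (sym ey)
              f-eq : f ∘ (x ∘ r′) ≈ f ∘ y
              f-eq = trans (sym (pullˡ factors)) (trans (∘-resp-≈ʳ (sym gx))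
                     (trans (pullˡ (pullˡ eq)) (trans (∘-resp-≈ˡ assoc) (trans assoc
                     (trans (∘-resp-≈ʳ hy) (pullˡ factors))))))
          in trans gx (trans (e-identifies f-eq) (sym hy))

  -- Congruences and the equivalence relation generated by parallel maps

  record IsCongruence {p} {k} (_~_ : ∀ {t} → t ⇒ p → t ⇒ p → Set k) : Set (o ⊔ ℓ ⊔ k) where
    field
      -- Taking an equation as argument makes the relation respect `_≈_`.
      reflexive  : ∀ {t} {x y : t ⇒ p} → x ≈ y → x ~ y
      symmetric  : ∀ {t} {x y : t ⇒ p} → x ~ y → y ~ x
      transitive : ∀ {t} {x y z : t ⇒ p} → x ~ y → y ~ z → x ~ z

  module Generated {M : Set ℓ} {A : M → Obj} {p : Obj} (s t : ∀ m → A m ⇒ p) where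

    mutual
      -- Elements of `apex w` are the instances of `w`, each linking its `source` to its `target`;
      -- the pullback matches the middle ends of a composite.
      apex : Derivation M → Obj
      apex (gen m)       = A m
      apex reflex        = p
      apex (symm w)      = apex w
      apex (compose w v) = Pullback.obj (pullback (target w) (source v))

      source : ∀ w → apex w ⇒ p
      source (gen m)       = s m
      source reflex        = id
      source (symm w)      = target w
      source (compose w v) = source w ∘ Pullback.p₁ (pullback (target w) (source v))

      target : ∀ w → apex w ⇒ p
      target (gen m)       = t m
      target reflex        = id
      target (symm w)      = source w
      target (compose w v) = target v ∘ Pullback.p₂ (pullback (target w) (source v))

    Z = coproduct apex
    module Z = Coproduct Z

    ends : Z.obj ⇒ p ⊗ p
    ends = Z.copair λ w → ⟨ source w , target w ⟩

    open Image (image ends) using (locally; ∈-image) renaming (sub to E)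

    l r : dom E ⇒ p
    l = π₁ ∘ arr E
    r = π₂ ∘ arr E

    derivation-∈ : ∀ {y} {u v : y ⇒ p} w (z : y ⇒ apex w) →
                   source w ∘ z ≈ u → target w ∘ z ≈ v → ⟨ u , v ⟩ ∈ E
    derivation-∈ w z p q = ∈-resp-≈ {S = E}
      (trans (pullˡ (Z.factors w)) (trans ⟨⟩-∘ (⟨⟩-cong p q)))
      (∈-image (Z.ι w ∘ z))

    -- The converse of `derivation-∈`, on a cover: an element of the image comes locally from `Z`,
    -- and then from a summand.
    E-locally : Locally (dom E) λ {z} g →
      Σ[ w ∈ Derivation M ] Σ[ x ∈ z ⇒ apex w ] (source w ∘ x ≈ l ∘ g × target w ∘ x ≈ r ∘ g)
    E-locally f x S H = locally f x S λ g p (y , q) →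
      coproduct-locally Z.isCoproduct y (x ∘ g) S λ g′ p′ (w , z , q′) →
        let eq : ⟨ source w ∘ z , target w ∘ z ⟩ ≈ arr E ∘ (_ ∘ g′)
            eq = trans (sym ⟨⟩-∘) (trans (sym (pullˡ (Z.factors w)))
                 (trans (∘-resp-≈ʳ (trans q′ (sym p′))) (trans (pullˡ q) assoc)))
        in ∈-resp-≈ {S = S} (sym assoc) (H (g ∘ g′) (pullˡ p)
             (w , z , trans (sym project₁) (trans (∘-resp-≈ʳ eq) (sym assoc))
                    , trans (sym project₂) (trans (∘-resp-≈ʳ eq) (sym assoc))))

    compose-∈ : ∀ {y} {u v : y ⇒ p} w w′ (z : y ⇒ apex w) (z′ : y ⇒ apex w′) →
                source w ∘ z ≈ u → target w ∘ z ≈ source w′ ∘ z′ → target w′ ∘ z′ ≈ v →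
                ⟨ u , v ⟩ ∈ E
    compose-∈ w w′ z z′ p middle q = derivation-∈ (compose w w′) (PB.universal middle)
      (trans (pullʳ PB.project₁) p) (trans (pullʳ PB.project₂) q)
      where module PB = Pullback (pullback (target w) (source w′))

    -- Each axiom asks for a pair to lie in `E`. Where pairs in `E` are given, pass to a cover on
    -- which they come from derivations; the constructors of `Derivation` supply the rest.
    E-equivalence : IsEquivalenceRelation C l r
    E-equivalence = record
      { jointlyMonic = λ g h p q → mono E g h
          (⊗-ext (trans (sym assoc) (trans p assoc)) (trans (sym assoc) (trans q assoc)))
      ; reflexive    = split (derivation-∈ reflex id identityˡ identityˡ)
      ; symmetric    = split (E-locally id ⟨ r , l ⟩ E λ g p (w , z , lz , rz) →
          let g≈h = trans (sym identityˡ) p in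
          ∈-resp-≈ {S = E} (sym ⟨⟩-∘) (derivation-∈ (symm w) z
            (trans rz (∘-resp-≈ʳ (sym g≈h))) (trans lz (∘-resp-≈ʳ (sym g≈h)))))
      ; transitive   = λ {_} {u} {v} pb → split
          -- One cover gives a derivation for `u`, a finer one a derivation for `v`; the pullback
          -- square makes their middle ends agree.
          (E-locally u ⟨ l ∘ u , r ∘ v ⟩ E λ g p (w , z , lz , rz) →
           E-locally (v ∘ g) (⟨ l ∘ u , r ∘ v ⟩ ∘ g) E λ g′ p′ (w′ , z′ , lz′ , rz′) →
             ∈-resp-≈ {S = E} (trans (sym ⟨⟩-∘) (sym assoc))
               (compose-∈ w w′ (z ∘ g′) z′
                 (trans (pullˡ lz) (trans assoc (trans (∘-resp-≈ʳ (sym (pullˡ p))) (sym assoc))))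
                 (trans (pullˡ rz) (trans assoc (trans (∘-resp-≈ʳ (sym (pullˡ p)))
                   (trans (pullˡ (IsPullback.commute pb)) (trans assoc
                   (trans (∘-resp-≈ʳ (trans (sym assoc) p′)) (sym lz′)))))))
                 (trans rz′ (trans (∘-resp-≈ʳ (trans (sym p′) assoc)) (sym assoc)))))
      }
      where
        split : ∀ {y} {u v : y ⇒ p} → ⟨ u , v ⟩ ∈ E →
                Σ[ k ∈ y ⇒ dom E ] (l ∘ k ≈ u × r ∘ k ≈ v)
        split (k , eq) = k , trans (pullʳ eq) project₁ , trans (pullʳ eq) project₂

    abstract
      quotient : Σ[ b ∈ Obj ] Σ[ f ∈ p ⇒ b ] IsPullback C f f l r
      quotient = effective E-equivalence

    class : p ⇒ proj₁ quotient
    class = proj₁ (proj₂ quotient)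

    open IsPullback (proj₂ (proj₂ quotient))
      using (commute; universal) renaming (project₁ to project₁′; project₂ to project₂′)

    class-identifies : ∀ m → class ∘ s m ≈ class ∘ t m
    class-identifies m =
      let k , eq = derivation-∈ (gen m) id identityʳ identityʳ in
      trans (∘-resp-≈ʳ (sym (trans (pullʳ eq) project₁)))
      (trans (pullˡ commute) (pullʳ (trans (pullʳ eq) project₂)))

    module _ {k} {_~_ : ∀ {y} → y ⇒ p → y ⇒ p → Set k} (cong : IsCongruence _~_)
             (generators : ∀ m {y} (x : y ⇒ A m) → (s m ∘ x) ~ (t m ∘ x)) where
      open IsCongruence cong

      derivation-~ : ∀ w {y} (x : y ⇒ apex w) → (source w ∘ x) ~ (target w ∘ x)
      derivation-~ (gen m)       x = generators m x
      derivation-~ reflex        x = reflexive ≈-refl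
      derivation-~ (symm w)      x = symmetric (derivation-~ w x)
      derivation-~ (compose w v) x =
        transitive (reflexive assoc)
        (transitive (derivation-~ w _)
        (transitive (reflexive (trans (pullˡ (Pullback.commute (pullback (target w) (source v)))) assoc))
        (transitive (derivation-~ v _) (reflexive (sym assoc)))))

      -- `E` is the kernel pair of `class`, so `u` and `v` are locally the ends of a derivation, and
      -- induction on it applies. The relation may be any congruence on generalised elements, so
      -- invariance properties can be used directly.
      class-kernel : ∀ {y} {u v : y ⇒ p} → class ∘ u ≈ class ∘ v →
                     Locally y λ g → (u ∘ g) ~ (v ∘ g)
      class-kernel {u = u} {v} eq f x S H =
        E-locally (universal eq ∘ f) x S λ g p (w , z , lz , rz) →
          H g ≈-refl
            (transitive (reflexive (trans (∘-resp-≈ˡ (sym project₁′)) (trans assoc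
                (trans (∘-resp-≈ʳ (trans (sym assoc) p)) (sym lz)))))
            (transitive (derivation-~ w z)
              (reflexive (trans rz (trans (∘-resp-≈ʳ (trans (sym p) assoc)) (pullˡ project₂′))))))

  -- Products as base change, and a criterion for regular epis

  module _ {b : Obj} where
    open Functor (-× b) using () renaming (F₁ to infixl 10 _×b)

    ×-⟨⟩ : ∀ {a a′ t} {f : a ⇒ a′} {x : t ⇒ a} {β : t ⇒ b} → f ×b ∘ ⟨ x , β ⟩ ≈ ⟨ f ∘ x , β ⟩
    ×-⟨⟩ = ⟨⟩-unique (trans (pullˡ project₁) (pullʳ project₁)) (trans (pullˡ project₂) project₂)

    -- `f ×b` is a base change of `f`, so the stability axioms apply to it.
    ×-pullback : ∀ {a a′} (f : a ⇒ a′) → IsPullback C f π₁ π₁ (f ×b)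
    ×-pullback f = record
      { commute   = sym project₁
      ; universal = λ {_} {h} {k} _ → ⟨ h , π₂ ∘ k ⟩
      ; project₁  = project₁
      ; project₂  = λ {_} {_} {_} {eq} → trans ×-⟨⟩ (sym (⟨⟩-unique (sym eq) ≈-refl))
      ; unique    = λ p q → ⟨⟩-unique p (trans (sym (pullˡ project₂)) (∘-resp-≈ʳ q))
      }

  -- The image inclusion is monic with section `r`, hence invertible; so `f` is its own cover up to
  -- isomorphism.
  total-image⇒regularEpi : ∀ {a b} {f : a ⇒ b} → id ∈ Image.sub (image f) → IsRegularEpi C f
  total-image⇒regularEpi {f = f} (r , mr≈id) = _ , _ , _ , record
    { equality   = trans (∘-resp-≈ˡ (sym factors)) (trans (pullʳ Q.equality) (pullˡ factors))
    ; coequalize = λ eq → Q.coequalize eq ∘ r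
    ; factors    = trans (pullʳ rf≈e) Q.factors
    ; unique     = λ {_} {_} {_} {u} uf≈h →
        trans (sym identityʳ) (trans (∘-resp-≈ʳ (sym mr≈id)) (pullˡ
          (Q.unique (trans (pullʳ factors) uf≈h))))
    }
    where
      open Image (image f)
      module Q = IsCoequalizer (proj₂ (proj₂ (proj₂ regularEpi)))
      rf≈e : r ∘ f ≈ cover
      rf≈e = mono sub _ _ (trans (pullˡ mr≈id) (trans identityˡ (sym factors)))

  -- Colimits in a pretopos

  module Colimit {J : Category ℓ ℓ ℓ} (D : Functor J (op C)) (K : Cone D) (isLimit : IsLimit K) where
    private module J = Category J
    open Functor D
    open Cone K renaming (apex to X)
    open IsLimit isLimit

    -- A limit cone in `op C` is a colimit cocone in `C`; an arrow from `i` to `j` in `J` acts as a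
    -- map `F₀ j ⇒ F₀ i`.
    κ : ∀ j → F₀ j ⇒ X
    κ = ψ

    P = coproduct F₀
    module P = Coproduct P

    Arrow : Set ℓ
    Arrow = Σ[ i ∈ J.Obj ] Σ[ j ∈ J.Obj ] (i J.⇒ j)

    open Generated {Arrow} {λ (i , j , f) → F₀ j} {P.obj}
      (λ (i , j , f) → P.ι j) (λ (i , j , f) → P.ι i ∘ F₁ f)
      using (class; class-identifies; class-kernel)

    q : P.obj ⇒ X
    q = P.copair κ

    -- The cocone factors through the image of `q`. The induced map `i` is a section of the image
    -- inclusion, since their composite and `id` both mediate from `K` to itself.
    q-regularEpi : IsRegularEpi C q
    q-regularEpi = total-image⇒regularEpi
      (i , trans (unique K _ λ j → trans (pullʳ (factors cocone j)) (I-κ j))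
                 (sym (unique K id λ j → identityˡ)))
      where
        module I = Image (image q)
        I-κ : ∀ j → arr I.sub ∘ (I.cover ∘ P.ι j) ≈ κ j
        I-κ j = trans (pullˡ I.factors) (P.factors j)
        cocone : Cone D
        cocone = record
          { ψ       = λ j → I.cover ∘ P.ι j
          ; commute = λ {i} {j} f → mono I.sub _ _
             (trans (pullˡ (I-κ i)) (trans (commute f) (sym (I-κ j))))
          }
        i : X ⇒ dom I.sub
        i = mediate cocone

    κ-locally : Locally X λ {z} y → Σ[ j ∈ J.Obj ] Σ[ x ∈ z ⇒ F₀ j ] κ j ∘ x ≈ y
    κ-locally f x S H = regularEpi-locally q-regularEpi f x S λ g p (u , qu) →
      coproduct-locally P.isCoproduct u (x ∘ g) S λ g′ p′ (j , y , ιy) →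
        ∈-resp-≈ {S = S} (sym assoc) (H (g ∘ g′) (pullˡ p) (j , y ,
          trans (sym (pullˡ (P.factors j))) (trans (∘-resp-≈ʳ (trans ιy (sym p′))) (pullˡ qu))))

    -- `class` restricts to a cocone, so it factors through `q` and identifies whatever `q`
    -- identifies.
    q-kernel : ∀ {k} {_~_ : ∀ {y} → y ⇒ P.obj → y ⇒ P.obj → Set k} → IsCongruence _~_ →
               (∀ {i j} (f : i J.⇒ j) {y} (x : y ⇒ F₀ j) → (P.ι j ∘ x) ~ ((P.ι i ∘ F₁ f) ∘ x)) →
               ∀ {y} {u v : y ⇒ P.obj} → q ∘ u ≈ q ∘ v → Locally y λ g → (u ∘ g) ~ (v ∘ g)
    q-kernel cong generators eq = class-kernel cong (λ (_ , _ , f) → generators f)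
      (trans (∘-resp-≈ˡ (sym class≈)) (trans (pullʳ eq) (pullˡ class≈)))
      where
        cocone : Cone D
        cocone = record
          { ψ       = λ j → class ∘ P.ι j
          ; commute = λ f → trans assoc (sym (class-identifies (_ , _ , f)))
          }
        class≈ : mediate cocone ∘ q ≈ class
        class≈ = trans (P.unique λ j → trans (pullʳ (P.factors j)) (factors cocone j))
                       (sym (P.unique λ _ → ≈-refl))

    -- Maps out of the product of a colimit with `b`

    module Exponential (b c : Obj) where
      open Functor (-× b) using ()
        renaming (F₁ to infixl 10 _×b; F-resp-≈ to ×b-resp-≈; homomorphism to ×b-∘)

      -- Locally the first component comes from some `F₀ j`, so the element factors through
      -- `(κ j) ×b`.
      separated : {h h′ : X ⊗ b ⇒ c} → (∀ j → h ∘ (κ j) ×b ≈ h′ ∘ (κ j) ×b) → h ≈ h′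
      separated {h} {h′} eq = locally-≈ κ-locally π₁ λ g p (j , x , κx) →
        let g≈ : (κ j) ×b ∘ ⟨ x , π₂ ∘ g ⟩ ≈ g
            g≈ = trans ×-⟨⟩ (sym (⟨⟩-unique (trans p (sym κx)) ≈-refl))
        in trans (∘-resp-≈ʳ (sym g≈)) (trans (pullˡ (eq j)) (pullʳ g≈))

      module Glue (h : ∀ j → F₀ j ⊗ b ⇒ c)
                  (compatible : ∀ {i j} (f : i J.⇒ j) → h i ∘ (F₁ f) ×b ≈ h j) where

        P×b : IsCoproduct C (λ j → F₀ j ⊗ b) (λ j → (P.ι j) ×b)
        P×b = stable P.isCoproduct π₁ λ j → IsPullback-swap (×-pullback {b} (P.ι j))

        module P×b = IsCoproduct P×b

        h̃ : P.obj ⊗ b ⇒ c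
        h̃ = P×b.copair h

        -- Stands in for equality of transposes into an exponential of `c` by `b`, which might not
        -- exist.
        _~_ : ∀ {y} → y ⇒ P.obj → y ⇒ P.obj → Set ℓ
        _~_ {y} u v = ∀ (β : y ⇒ b) → h̃ ∘ ⟨ u , β ⟩ ≈ h̃ ∘ ⟨ v , β ⟩

        congruence : IsCongruence _~_
        congruence = record
          { reflexive  = λ p β → ∘-resp-≈ʳ (⟨⟩-cong p ≈-refl)
          ; symmetric  = λ p β → sym (p β)
          ; transitive = λ p q β → trans (p β) (q β)
          }

        h̃-ι : ∀ j {z} (x : z ⇒ F₀ j) (β : z ⇒ b) → h̃ ∘ ⟨ P.ι j ∘ x , β ⟩ ≈ h j ∘ ⟨ x , β ⟩
        h̃-ι j x β = trans (∘-resp-≈ʳ (sym ×-⟨⟩)) (pullˡ (P×b.factors j))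

        generators : ∀ {i j} (f : i J.⇒ j) {y} (x : y ⇒ F₀ j) →
                     (P.ι j ∘ x) ~ ((P.ι i ∘ F₁ f) ∘ x)
        generators {i} {j} f x β =
          trans (h̃-ι j x β)
          (trans (sym (trans (∘-resp-≈ʳ (sym ×-⟨⟩)) (pullˡ (compatible f))))
          (trans (sym (h̃-ι i (F₁ f ∘ x) β))
          (∘-resp-≈ʳ (⟨⟩-cong (sym assoc) ≈-refl))))

        module Q = IsCoequalizer
          (proj₂ (proj₂ (proj₂ (regularEpiStable (×-pullback {b} q) q-regularEpi))))

        -- The elements share their `b`-component, and `q` identifies their first components, which
        -- are therefore locally related; the relation is applied at the shared component.
        coequalizes : ∀ {y} {u v : y ⇒ P.obj ⊗ b} → q ×b ∘ u ≈ q ×b ∘ v → h̃ ∘ u ≈ h̃ ∘ v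
        coequalizes {y} {u} {v} eq =
          locally-≈ (q-kernel congruence generators q-eq) id λ g {g′} p uv →
            let expand : {w : y ⇒ P.obj ⊗ b} →
                         w ∘ g ≈ ⟨ (π₁ ∘ w) ∘ g′ , (π₂ ∘ w) ∘ g ⟩
                expand = ⟨⟩-unique
                  (trans (sym assoc) (∘-resp-≈ʳ (trans (sym identityˡ) p))) (sym assoc)
            in trans (pullʳ expand) (trans (uv ((π₂ ∘ u) ∘ g))
               (sym (pullʳ (trans expand (⟨⟩-cong ≈-refl (∘-resp-≈ˡ (sym π₂-eq)))))))
          where
            q-eq : q ∘ (π₁ ∘ u) ≈ q ∘ (π₁ ∘ v)
            q-eq = trans (pullˡ (sym project₁)) (trans (pullʳ eq)
                   (trans (sym assoc) (trans (∘-resp-≈ˡ project₁) assoc)))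
            π₂-eq : π₂ ∘ u ≈ π₂ ∘ v
            π₂-eq = trans (∘-resp-≈ˡ (sym project₂)) (trans (pullʳ eq) (pullˡ project₂))

        glue : X ⊗ b ⇒ c
        glue = Q.coequalize (coequalizes Q.equality)

        glue-κ : ∀ j → glue ∘ (κ j) ×b ≈ h j
        glue-κ j = trans (∘-resp-≈ʳ (trans (×b-resp-≈ (sym (P.factors j))) ×b-∘))
                   (trans (pullˡ Q.factors) (P×b.factors j))

    -- Subobjects of a colimit

    infix 10 _⁎_
    _⁎_ : ∀ {c d} → d ⇒ c → Subobject C c → Subobject C d
    _⁎_ = _*_ C finiteLimits

    -- Locally an element of `S` is `κ j ∘ x`, with `x` in the restriction of `S` and hence in that
    -- of `T`.
    reflects-≤ : ∀ {S T : Subobject C X} → (∀ j → arr (κ j ⁎ S) ∈ κ j ⁎ T) → arr S ∈ T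
    reflects-≤ {S} {T} le = κ-locally (arr S) (arr S) T λ g p (j , x , κx) →
      ∈-resp-≈ {S = T} (trans κx (sym p))
        (∈-*⁻¹ {S = T} (∈-≤ {S = κ j ⁎ S} {κ j ⁎ T} (le j)
          (∈-* {S = S} (g , trans p (sym κx)))))

    module GlueSubobjects (S : ∀ j → Subobject C (F₀ j))
      (compatible : ∀ {i j} (f : i J.⇒ j) → Setoid._≈_ (subobjects C (F₀ j)) (F₁ f ⁎ S i) (S j))
      where

      -- u factors through ∐ S j → P, phrased so that ∐ S j need not be shown to be a
      -- subobject of P.
      InS : ∀ {y} → y ⇒ P.obj → Set (o ⊔ ℓ)
      InS {y} u = ∀ {z} (f : z ⇒ y) j (x : z ⇒ F₀ j) → u ∘ f ≈ P.ι j ∘ x → x ∈ S j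

      InS-resp-≈ : ∀ {y} {u v : y ⇒ P.obj} → u ≈ v → InS u → InS v
      InS-resp-≈ p m f j x eq = m f j x (trans (∘-resp-≈ˡ p) eq)

      -- If the element also factors through another summand, disjointness makes the two indices
      -- locally equal, and then the injection is cancelled.
      ∈⇒InS : ∀ {j y} {x : y ⇒ F₀ j} → x ∈ S j → InS (P.ι j ∘ x)
      ∈⇒InS {i} {x = x} m f j x′ eq =
        disjoint-locally P.isCoproduct eq′ id x′ (S j) λ g _ i≡j → same i≡j g x′ eq′
        where
          eq′ : P.ι i ∘ (x ∘ f) ≈ P.ι j ∘ x′
          eq′ = trans (sym assoc) eq
          same : ∀ {j} → i ≡ j → ∀ {z} (g : z ⇒ _) (x′ : _ ⇒ F₀ j) →
                 P.ι i ∘ (x ∘ f) ≈ P.ι j ∘ x′ → x′ ∘ g ∈ S j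
          same refl g x′ eq = ∈-∘ {S = S i} (∈-resp-≈ {S = S i}
            (Disjoint.injectionMono (disjoint P.isCoproduct) i _ _ eq) (∈-∘ {S = S i} m))

      InS⇒∈ : ∀ {j y} {x : y ⇒ F₀ j} → InS (P.ι j ∘ x) → x ∈ S j
      InS⇒∈ {j} {x = x} m = m id j x identityʳ

      _~_ : ∀ {y} → y ⇒ P.obj → y ⇒ P.obj → Set (o ⊔ ℓ)
      u ~ v = (InS u → InS v) × (InS v → InS u)

      congruence : IsCongruence _~_
      congruence = record
        { reflexive  = λ p → InS-resp-≈ p , InS-resp-≈ (sym p)
        ; symmetric  = λ (p , p′) → p′ , p
        ; transitive = λ (p , p′) (q , q′) → (λ m → q (p m)) , (λ m → p′ (q′ m))
        }

      generators : ∀ {i j} (f : i J.⇒ j) {y} (x : y ⇒ F₀ j) →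
                   (P.ι j ∘ x) ~ ((P.ι i ∘ F₁ f) ∘ x)
      generators {i} {j} f x =
          (λ m → InS-resp-≈ (sym assoc) (∈⇒InS (∈-*⁻¹ {S = S i}
            (∈-≤ {S = S j} {F₁ f ⁎ S i} (proj₂ (compatible f)) (InS⇒∈ m)))))
        , (λ m → ∈⇒InS (∈-≤ {S = F₁ f ⁎ S i} {S j} (proj₁ (compatible f))
            (∈-* {S = S i} (InS⇒∈ (InS-resp-≈ assoc m)))))

      module ∐S = Coproduct (coproduct λ j → dom (S j))

      inclusion : ∐S.obj ⇒ X
      inclusion = ∐S.copair λ j → κ j ∘ arr (S j)

      module T = Image (image inclusion)

      glue : Subobject C X
      glue = T.sub

      -- The descent step. Locally `κ j ∘ x` comes from an element of some `S i`, so `q` identifies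
      -- that element with `x`, both taken in `P`. On a further cover they are related, which
      -- carries membership from `S i` to `S j`.
      κ∈glue⇒∈ : ∀ {j y} {x : y ⇒ F₀ j} → κ j ∘ x ∈ glue → x ∈ S j
      κ∈glue⇒∈ {j} {x = x} (k , Tk) =
        T.locally k x (S j) λ g p (s , eq) →
        coproduct-locally ∐S.isCoproduct s (x ∘ g) (S j) λ g′ p′ (i , z , ιz) →
        let same-image : q ∘ (P.ι i ∘ (arr (S i) ∘ z)) ≈ q ∘ (P.ι j ∘ ((x ∘ g) ∘ g′))
            same-image = trans (pullˡ (P.factors i)) (trans (sym assoc)
              (trans (sym (pullˡ (∐S.factors i))) (trans (∘-resp-≈ʳ (trans ιz (sym p′)))
              (trans (pullˡ eq) (trans (∘-resp-≈ˡ (trans (∘-resp-≈ʳ (sym p)) (pullˡ Tk)))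
              (trans (∘-resp-≈ˡ assoc) (trans assoc (sym (pullˡ (P.factors j))))))))))
        in q-kernel congruence generators same-image id ((x ∘ g) ∘ g′) (S j) λ g″ {h″} p″ related →
          ∈-resp-≈ {S = S j} (∘-resp-≈ʳ (trans (sym p″) identityˡ))
            (InS⇒∈ (InS-resp-≈ assoc (proj₁ related
              (InS-resp-≈ (sym assoc) (∈⇒InS (z ∘ h″ , sym assoc))))))

      glue-κ : ∀ j → Setoid._≈_ (subobjects C (F₀ j)) (κ j ⁎ glue) (S j)
      glue-κ j =
          κ∈glue⇒∈ (∈-*⁻¹ {S = glue} {x = arr (κ j ⁎ glue)} (id , identityʳ))
        , ∈-* {S = glue} (∈-resp-≈ {S = glue} (∐S.factors j) (T.∈-image (∐S.ι j)))

  -- Both presheaves are virtual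

  exponential-virtual : ∀ b c → IsVirtual C (よ C c ∘F opF (-× b))
  exponential-virtual b c J D K isLimit = record
    { mediate = λ L → record
      { to   = amalgam L
      ; cong = λ {x} {y} x≈y → separated λ j → trans (amalgam-κ L x j)
          (trans (Func.cong (Cone.ψ L j) x≈y) (sym (amalgam-κ L y j)))
      }
    ; factors = λ L j x → amalgam-κ L x j
    ; unique  = λ L h p x → separated λ j → trans (p j x) (sym (amalgam-κ L x j))
    }
    where
      open Colimit D K isLimit
      open Exponential b c
      -- An element of the apex of `L` is a compatible family, the input for gluing.
      module _ (L : Cone ((よ C c ∘F opF (-× b)) ∘F D)) (x : Setoid.Carrier (Cone.apex L)) where
        open Glue (λ j → Func.to (Cone.ψ L j) x) (λ f → Cone.commute L f x) public
          using () renaming (glue to amalgam; glue-κ to amalgam-κ)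

  Sub-virtual : IsVirtual C (Sub C finiteLimits)
  Sub-virtual J D K isLimit = record
    { mediate = λ L → record
      { to   = amalgam L
      ; cong = λ {x} {y} x≈y → determined {amalgam L x} {amalgam L y} (λ j → Func.to (Cone.ψ L j) y)
          (λ j → Setoid.trans (subobjects C (Functor.F₀ D j))
            {κ j ⁎ amalgam L x} {Func.to (Cone.ψ L j) x} {Func.to (Cone.ψ L j) y}
            (amalgam-κ L x j) (Func.cong (Cone.ψ L j) x≈y))
          (amalgam-κ L y)
      }
    ; factors = λ L j x → amalgam-κ L x j
    ; unique  = λ L h p x → determined {Func.to h x} {amalgam L x} (λ j → Func.to (Cone.ψ L j) x)
        (λ j → p j x) (amalgam-κ L x)
    }
    where
      open Colimit D K isLimit
      module _ (L : Cone (Sub C finiteLimits ∘F D)) (x : Setoid.Carrier (Cone.apex L)) where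
        open GlueSubobjects (λ j → Func.to (Cone.ψ L j) x) (λ f → Cone.commute L f x) public
          using () renaming (glue to amalgam; glue-κ to amalgam-κ)
      -- Uniqueness of gluing: `V` is the common family of restrictions, and both inclusions are
      -- reflected.
      determined : ∀ {S T} (V : ∀ j → Subobject C (Functor.F₀ D j)) →
                   (∀ j → Setoid._≈_ (subobjects C _) (κ j ⁎ S) (V j)) →
                   (∀ j → Setoid._≈_ (subobjects C _) (κ j ⁎ T) (V j)) →
                   Setoid._≈_ (subobjects C (Cone.apex K)) S T
      determined {S} {T} V p q =
          reflects-≤ {S} {T} (λ j → ∈-≤ {S = V j} {κ j ⁎ T} (proj₂ (q j)) (proj₁ (p j)))
        , reflects-≤ {T} {S} (λ j → ∈-≤ {S = V j} {κ j ⁎ S} (proj₂ (p j)) (proj₁ (q j)))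

corollary5p2p5 : ∀ {o ℓ : Level} (C : Category o ℓ ℓ) →
    InfinitaryPretopos C → HasSpecification C → PredicativeTopos C
corollary5p2p5 C pretopos specification = record
  { finiteLimits               = Exact.finiteLimits (InfinitaryPretopos.exact pretopos)
  ; virtuallyCartesianClosed   = exponential-virtual
  ; specification              = specification
  ; virtualSubobjectClassifier = Sub-virtual
  }
  where open Pretopos C pretopos
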